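{- Let $\varphi$ be an $\mathrm{LTL}_{\mathcal T}$ specification over environment variables $x$ and system variables $y$. If there is some unrolling depth $k\ge1$ such that the conditional unrolling formula $$\exists x^0.\forall y^0.\ \exists x^1.\forall y^1.\ \cdots\ \exists x^{k-1}.\forall y^{k-1}.\ \neg[\varphi]^{0,k}$$ is satisfiable in $\mathcal T$ (i.e. true in the structure of $\mathcal T$), then $\varphi$ is unrealizable.
   Context: Fix a first-order theory $\mathcal T$ interpreted in its intended structure, a finite tuple $x$ of environment variables and a finite tuple $y$ of system variables ranging over the domain(s) of $\mathcal T$. $\mathrm{LTL}_{\mathcal T}$ formulae are LTL formulae (Booleans, next $\bigcirc$, until $\mathcal U$, and derived operators such as always $\square$ and release $\mathcal R$) whose atoms are literals $l(x,y)$ of $\mathcal T$ over the variables of the current instant. Traces are infinite sequences $\sigma$ of valuations of $(x,y)$; $\sigma\models l$ iff the valuation $\sigma(0)$ makes $l$ true in $\mathcal T$, and the other cases are as in LTL. Realizability: in each turn $i=0,1,2,\dots$ the environment picks a value $x^i$ and then the system picks a value $y^i$. A system strategy determines $y^i$ from $x^0,\dots,x^i$; it is winning if every resulting trace satisfies $\varphi$. $\varphi$ is realizable if the system has a winning strategy, and unrealizable otherwise. Unrolling: put $\varphi$ in negation normal form (negations only on atoms; operators $\wedge,\vee,\bigcirc,\mathcal U,\mathcal R$, with $\square\psi=\bot\,\mathcal R\,\psi$). For $k\ge1$ and copies $x^0,\dots,x^{k-1},y^0,\dots,y^{k-1}$ of the variables define the $\mathcal T$-formula $[\psi]^{i,k}$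 by: $[\psi]^{i,k}=\top$ if $i\ge k$; and for $i<k$, $[l]^{i,k}=l(x^i,y^i)$ and $[\neg l]^{i,k}=\neg l(x^i,y^i)$; $[\cdot]^{i,k}$ commutes with $\wedge,\vee$ and the constants; $[\bigcirc\psi]^{i,k}=[\psi]^{i+1,k}$; $[\psi_1\,\mathcal U\,\psi_2]^{i,k}=[\psi_2]^{i,k}\vee([\psi_1]^{i,k}\wedge[\psi_1\,\mathcal U\,\psi_2]^{i+1,k})$; $[\psi_1\,\mathcal R\,\psi_2]^{i,k}=[\psi_2]^{i,k}\wedge([\psi_1]^{i,k}\vee[\psi_1\,\mathcal R\,\psi_2]^{i+1,k})$. For $\varphi=\square\psi$ this gives $[\varphi]^{0,k}\equiv\bigwedge_{i<k}[\psi]^{i,k}$. -}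

module Defs where

open import Data.Empty.Polymorphic using (⊥)
open import Data.List using (List; []; _∷_; _++_)
open import Data.List.Membership.Propositional using (_∈_)
open import Data.List.Membership.Propositional.Properties
  using (∈-++⁺ˡ; ∈-++⁺ʳ; ∈-++⁻)
open import Data.List.Relation.Binary.Subset.Propositional using (_⊆_)
open import Data.List.Relation.Unary.All using (All; []; _∷_; lookup)
open import Data.List.Relation.Unary.All.Properties using (++⁺)
open import Data.Fin using (toℕ)
open import Data.Nat using (ℕ; zero; suc; _∸_; _≤_; _<_; z≤n; s≤s; s≤s⁻¹)
open import Data.Nat.Properties using (m∸n≤m; <⇒≤; m≤n⇒m∸n≡0; +-∸-assoc)
open import Data.Product using (Σ; _×_; _,_; proj₁; proj₂; ∃-syntax)
open import Data.Sum using (_⊎_; [_,_]′)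
open import Data.Unit.Polymorphic using (⊤)
open import Data.Vec using (Vec; tabulate)
open import Function using (_∘_)
open import Level using (Level) renaming (suc to lsuc)
open import Relation.Binary.PropositionalEquality
  using (_≡_; refl; sym; trans; cong; cong₂)
open import Relation.Nullary using (¬_)

-- Equality, when a theory has it, is one of the relation symbols.
record Signature : Set₁ where
  field
    Sort  : Set
    Func  : Set
    dom   : Func → List Sort
    cod   : Func → Sort
    Rel   : Set
    arity : Rel → List Sort

open Signature public

-- A tuple of sorted variables is the list of their sorts, and a variable of
-- sort s is a position of s in that list.
data Term (S : Signature) (Γ : List (Sort S)) : Sort S → Set where
  var : ∀ {s} → s ∈ Γ → Term S Γ s
  app : (f : Func S) → All (Term S Γ) (dom S f) → Term S Γ (cod S f)

data Literal (S : Signature) (Γ : List (Sort S)) : Set where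
  pos neg : (r : Rel S) → All (Term S Γ) (arity S r) → Literal S Γ

infixr 6 _∧̇_
infixr 5 _∨̇_
infixr 4 _⇒̇_
infix  7 ¬̇_

data Formula (S : Signature) (Γ : List (Sort S)) : Set where
  atom           : (r : Rel S) → All (Term S Γ) (arity S r) → Formula S Γ
  ⊤̇ ⊥̇            : Formula S Γ
  ¬̇_             : Formula S Γ → Formula S Γ
  _∧̇_ _∨̇_ _⇒̇_    : Formula S Γ → Formula S Γ → Formula S Γ
  ∃̇ ∀̇            : (s : Sort S) → Formula S (s ∷ Γ) → Formula S Γ

Sentence : Signature → Set
Sentence S = Formula S []

module _ {S : Signature} where

  ⌊_⌋ : ∀ {Γ} → Literal S Γ → Formula S Γ
  ⌊ pos r ts ⌋ = atom r ts
  ⌊ neg r ts ⌋ = ¬̇ atom r ts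

  mutual
    renameTerm : ∀ {Γ Δ s} → Γ ⊆ Δ → Term S Γ s → Term S Δ s
    renameTerm ρ (var v)    = var (ρ v)
    renameTerm ρ (app f ts) = app f (renameTerms ρ ts)

    renameTerms : ∀ {Γ Δ ss} → Γ ⊆ Δ → All (Term S Γ) ss → All (Term S Δ) ss
    renameTerms ρ []       = []
    renameTerms ρ (t ∷ ts) = renameTerm ρ t ∷ renameTerms ρ ts

  renameLiteral : ∀ {Γ Δ} → Γ ⊆ Δ → Literal S Γ → Literal S Δ
  renameLiteral ρ (pos r ts) = pos r (renameTerms ρ ts)
  renameLiteral ρ (neg r ts) = neg r (renameTerms ρ ts)

  ∃* ∀* : (Δ : List (Sort S)) {Γ : List (Sort S)} →
          Formula S (Δ ++ Γ) → Formula S Γ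
  ∃* []      A = A
  ∃* (s ∷ Δ) A = ∃* Δ (∃̇ s A)
  ∀* []      A = A
  ∀* (s ∷ Δ) A = ∀* Δ (∀̇ s A)

record Structure (ℓ : Level) (S : Signature) : Set (lsuc ℓ) where
  field
    Carrier : Sort S → Set ℓ
    funcᴵ   : (f : Func S) → All Carrier (dom S f) → Carrier (cod S f)
    relᴵ    : (r : Rel S) → All Carrier (arity S r) → Set ℓ

  Valuation : List (Sort S) → Set ℓ
  Valuation = All Carrier

  mutual
    eval : ∀ {Γ s} → Valuation Γ → Term S Γ s → Carrier s
    eval ρ (var v)    = lookup ρ v
    eval ρ (app f ts) = funcᴵ f (evals ρ ts)

    evals : ∀ {Γ ss} → Valuation Γ → All (Term S Γ) ss → All Carrier ss
    evals ρ []       = []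
    evals ρ (t ∷ ts) = eval ρ t ∷ evals ρ ts

  Sat : ∀ {Γ} → Valuation Γ → Formula S Γ → Set ℓ
  Sat ρ (atom r ts) = relᴵ r (evals ρ ts)
  Sat ρ ⊤̇           = ⊤
  Sat ρ ⊥̇           = ⊥
  Sat ρ (¬̇ A)       = ¬ Sat ρ A
  Sat ρ (A ∧̇ B)     = Sat ρ A × Sat ρ B
  Sat ρ (A ∨̇ B)     = Sat ρ A ⊎ Sat ρ B
  Sat ρ (A ⇒̇ B)     = Sat ρ A → Sat ρ B
  Sat ρ (∃̇ s A)     = Σ (Carrier s) λ d → Sat (d ∷ ρ) A
  Sat ρ (∀̇ s A)     = (d : Carrier s) → Sat (d ∷ ρ) A

infix 3 _⊨_

_⊨_ : ∀ {ℓ S} → Structure ℓ S → Sentence S → Set ℓ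
M ⊨ A = Structure.Sat M [] A

record Theory (ℓ : Level) : Set (lsuc ℓ) where
  field
    signature : Signature
    Axiom     : Sentence signature → Set ℓ
    structure : Structure ℓ signature
    isModel   : ∀ {A} → Axiom A → structure ⊨ A

open Theory public

infix  7 ○_
infixr 6 _U_ _R_

data LTL (S : Signature) (X Y : List (Sort S)) : Set where
  lit      : Literal S (X ++ Y) → LTL S X Y
  ⊤̇ ⊥̇      : LTL S X Y
  ¬̇_       : LTL S X Y → LTL S X Y
  _∧̇_ _∨̇_  : LTL S X Y → LTL S X Y → LTL S X Y
  ○_       : LTL S X Y → LTL S X Y
  _U_      : LTL S X Y → LTL S X Y → LTL S X Y

-- Negation normal forms; neglit l is the negation of the literal l.
data NNF (S : Signature) (X Y : List (Sort S)) : Set where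
  lit neglit : Literal S (X ++ Y) → NNF S X Y
  ⊤̇ ⊥̇        : NNF S X Y
  _∧̇_ _∨̇_    : NNF S X Y → NNF S X Y → NNF S X Y
  ○_         : NNF S X Y → NNF S X Y
  _U_ _R_    : NNF S X Y → NNF S X Y → NNF S X Y

module _ {S : Signature} {X Y : List (Sort S)} where

  _release_ : LTL S X Y → LTL S X Y → LTL S X Y
  φ release ψ = ¬̇ ((¬̇ φ) U (¬̇ ψ))

  always : LTL S X Y → LTL S X Y
  always ψ = ⊥̇ release ψ

  mutual
    nnf : LTL S X Y → NNF S X Y
    nnf (lit l) = lit l
    nnf ⊤̇       = ⊤̇
    nnf ⊥̇       = ⊥̇
    nnf (¬̇ φ)   = nnf¬ φ
    nnf (φ ∧̇ ψ) = nnf φ ∧̇ nnf ψ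
    nnf (φ ∨̇ ψ) = nnf φ ∨̇ nnf ψ
    nnf (○ φ)   = ○ nnf φ
    nnf (φ U ψ) = nnf φ U nnf ψ

    -- The normal form of ¬̇ φ.
    nnf¬ : LTL S X Y → NNF S X Y
    nnf¬ (lit l) = neglit l
    nnf¬ ⊤̇       = ⊥̇
    nnf¬ ⊥̇       = ⊤̇
    nnf¬ (¬̇ φ)   = nnf φ
    nnf¬ (φ ∧̇ ψ) = nnf¬ φ ∨̇ nnf¬ ψ
    nnf¬ (φ ∨̇ ψ) = nnf¬ φ ∧̇ nnf¬ ψ
    nnf¬ (○ φ)   = ○ nnf¬ φ
    nnf¬ (φ U ψ) = nnf¬ φ R nnf¬ ψ

  nnf-release : ∀ φ ψ → nnf (φ release ψ) ≡ nnf φ R nnf ψ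
  nnf-release φ ψ = refl

module _ {ℓ : Level} {S : Signature} (M : Structure ℓ S) {X Y : List (Sort S)} where
  open Structure M

  Trace : Set ℓ
  Trace = ℕ → Valuation X × Valuation Y

  suffix : ℕ → Trace → Trace
  suffix zero    σ = σ
  suffix (suc i) σ = suffix i (σ ∘ suc)

  Models : Trace → LTL S X Y → Set ℓ
  Models σ (lit l) = Sat (++⁺ (proj₁ (σ 0)) (proj₂ (σ 0))) ⌊ l ⌋
  Models σ ⊤̇       = ⊤
  Models σ ⊥̇       = ⊥
  Models σ (¬̇ φ)   = ¬ Models σ φ
  Models σ (φ ∧̇ ψ) = Models σ φ × Models σ ψ
  Models σ (φ ∨̇ ψ) = Models σ φ ⊎ Models σ ψ
  Models σ (○ φ)   = Models (suffix 1 σ) φ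
  Models σ (φ U ψ) = ∃[ j ] Models (suffix j σ) ψ ×
                            (∀ i → i < j → Models (suffix i σ) φ)

module _ {ℓ : Level} {S : Signature} (M : Structure ℓ S) (X Y : List (Sort S)) where
  open Structure M

  -- The system's move at turn i depends on x⁰, …, xⁱ (listed in this order).
  Strategy : Set ℓ
  Strategy = (i : ℕ) → Vec (Valuation X) (suc i) → Valuation Y

  outcome : Strategy → (ℕ → Valuation X) → Trace M {X} {Y}
  outcome s ξ i = ξ i , s i (tabulate (ξ ∘ toℕ))

module _ {ℓ : Level} {S : Signature} (M : Structure ℓ S) {X Y : List (Sort S)} where
  open Structure M

  Winning : LTL S X Y → Strategy M X Y → Set ℓ
  Winning φ s = (ξ : ℕ → Valuation X) → Models M (outcome M X Y s ξ) φ

  Realizable : LTL S X Y → Set ℓ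
  Realizable φ = Σ (Strategy M X Y) (Winning φ)

  Unrealizable : LTL S X Y → Set ℓ
  Unrealizable φ = ¬ Realizable φ

module _ (S : Signature) (X Y : List (Sort S)) where

  -- The variables x⁰, y⁰, …, xᵏ⁻¹, yᵏ⁻¹, with the latest copy in front.
  Copies : ℕ → List (Sort S)
  Copies zero    = []
  Copies (suc k) = Y ++ X ++ Copies k

  -- Since the latest copy is in front, the copy with d further copies before
  -- it in the list is the one of instant i = k ∸ suc d.
  copy : ∀ d k → .(d < k) → X ++ Y ⊆ Copies k
  copy zero    (suc k) _   v = [ ∈-++⁺ʳ Y ∘ ∈-++⁺ˡ , ∈-++⁺ˡ ]′ (∈-++⁻ X v)
  copy (suc d) (suc k) d<k v = ∈-++⁺ʳ Y (∈-++⁺ʳ X (copy d k (s≤s⁻¹ d<k) v))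

  closeCopies : ∀ k → Formula S (Copies k) → Sentence S
  closeCopies zero    A = A
  closeCopies (suc k) A = closeCopies k (∃* X (∀* Y A))

module _ {S : Signature} {X Y : List (Sort S)} where

  -- The recursion is on the number d = k ∸ i of instants left, so that
  -- unrollFrom k d is the unrolling at instant i, and passing from suc d to d
  -- is passing from i to suc i.
  unrollFrom : ∀ k d → .(d ≤ k) → NNF S X Y → Formula S (Copies S X Y k)
  unrollFrom k zero    _ _          = ⊤̇
  unrollFrom k (suc d) p (lit l)    = ⌊ renameLiteral (copy S X Y d k p) l ⌋
  unrollFrom k (suc d) p (neglit l) = ¬̇ ⌊ renameLiteral (copy S X Y d k p) l ⌋
  unrollFrom k (suc d) p ⊤̇          = ⊤̇
  unrollFrom k (suc d) p ⊥̇          = ⊥̇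
  unrollFrom k (suc d) p (φ ∧̇ ψ)    = unrollFrom k (suc d) p φ ∧̇ unrollFrom k (suc d) p ψ
  unrollFrom k (suc d) p (φ ∨̇ ψ)    = unrollFrom k (suc d) p φ ∨̇ unrollFrom k (suc d) p ψ
  unrollFrom k (suc d) p (○ φ)      = unrollFrom k d (<⇒≤ p) φ
  unrollFrom k (suc d) p (φ U ψ)    =
    unrollFrom k (suc d) p ψ ∨̇ (unrollFrom k (suc d) p φ ∧̇ unrollFrom k d (<⇒≤ p) (φ U ψ))
  unrollFrom k (suc d) p (φ R ψ)    =
    unrollFrom k (suc d) p ψ ∧̇ (unrollFrom k (suc d) p φ ∨̇ unrollFrom k d (<⇒≤ p) (φ R ψ))

  -- unroll i k ψ is [ψ]^{i,k}.
  unroll : ∀ i k → NNF S X Y → Formula S (Copies S X Y k)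
  unroll i k = unrollFrom k (k ∸ i) (m∸n≤m k i)

  conditionalUnrolling : ℕ → LTL S X Y → Sentence S
  conditionalUnrolling k φ = closeCopies S X Y k (¬̇ unroll 0 k (nnf φ))

  private
    unrollFrom-cong : ∀ {k d e} .(p : d ≤ k) .(q : e ≤ k) ψ → d ≡ e →
                      unrollFrom k d p ψ ≡ unrollFrom k e q ψ
    unrollFrom-cong p q ψ refl = refl

    step : ∀ {i k} → i < k → k ∸ i ≡ suc (k ∸ suc i)
    step i<k = +-∸-assoc 1 i<k

    bound : ∀ {i k} → i < k → suc (k ∸ suc i) ≤ k
    bound {i} {suc k} _ = s≤s (m∸n≤m k i)

    at : ∀ {i k} (i<k : i < k) ψ →
         unroll i k ψ ≡ unrollFrom k (suc (k ∸ suc i)) (bound i<k) ψ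
    at {i} {k} i<k ψ = unrollFrom-cong (m∸n≤m k i) (bound i<k) ψ (step i<k)

  unroll-≥ : ∀ {i k} → k ≤ i → ∀ ψ → unroll i k ψ ≡ ⊤̇
  unroll-≥ {i} {k} k≤i ψ = unrollFrom-cong (m∸n≤m k i) z≤n ψ (m≤n⇒m∸n≡0 k≤i)

  unroll-○ : ∀ {i k} → i < k → ∀ φ → unroll i k (○ φ) ≡ unroll (suc i) k φ
  unroll-○ i<k φ = at i<k (○ φ)

  unroll-U : ∀ {i k} → i < k → ∀ φ ψ →
             unroll i k (φ U ψ) ≡
             unroll i k ψ ∨̇ (unroll i k φ ∧̇ unroll (suc i) k (φ U ψ))
  unroll-U {i} {k} i<k φ ψ = trans (at i<k (φ U ψ))
    (cong₂ (λ A B → A ∨̇ (B ∧̇ unroll (suc i) k (φ U ψ))) (sym (at i<k ψ)) (sym (at i<k φ)))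

  unroll-R : ∀ {i k} → i < k → ∀ φ ψ →
             unroll i k (φ R ψ) ≡
             unroll i k ψ ∧̇ (unroll i k φ ∨̇ unroll (suc i) k (φ R ψ))
  unroll-R {i} {k} i<k φ ψ = trans (at i<k (φ R ψ))
    (cong₂ (λ A B → A ∧̇ (B ∨̇ unroll (suc i) k (φ R ψ))) (sym (at i<k ψ)) (sym (at i<k φ)))

{-# OPTIONS --safe #-}
module Submission where

-- A true conditional unrolling is a strategy for the environment during the
-- first k turns: played against any system strategy it produces a trace whose
-- first k instants falsify [φ]^{0,k}.  But [φ]^{0,k} holds on every trace
-- satisfying φ, since it only relaxes φ to ⊤ from instant k on.  As the
-- conclusion is a negation, this last fact is only needed up to ¬ ¬, which is
-- what makes the passage to negation normal form constructive.

open import Defs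
open import Level using (Level)
open import Data.List using (List; []; _∷_; _++_)
open import Data.List.Membership.Propositional using (_∈_)
open import Data.List.Membership.Propositional.Properties
  using (∈-++⁺ˡ; ∈-++⁺ʳ; ∈-++⁻)
open import Data.List.Relation.Binary.Subset.Propositional using (_⊆_)
open import Data.List.Relation.Unary.All using (All; []; _∷_; lookup)
open import Data.List.Relation.Unary.All.Properties using (++⁺)
open import Data.List.Relation.Unary.Any using (here; there)
open import Data.Fin using (toℕ)
open import Data.Fin.Properties using (toℕ<n)
open import Data.Nat using (ℕ; zero; suc; _∸_; _≤_; _<_; z≤n; s≤s; s≤s⁻¹; _≟_)
open import Data.Nat.Properties using (+-∸-assoc; <⇒≤; <⇒≢; <-≤-trans; m≤n⇒m≤1+n; n<1+n; n∸n≡0; ≤-refl)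
open import Data.Product using (Σ; _×_; _,_; proj₁; proj₂; ∃-syntax)
open import Data.Sum using (inj₁; inj₂; [_,_]′)
open import Data.Unit.Polymorphic using (tt)
open import Data.Vec.Properties using (tabulate-cong)
open import Function using (_∘_)
open import Relation.Binary.PropositionalEquality
  using (_≡_; refl; sym; trans; cong; cong₂; subst)
open import Relation.Nullary using (¬_; yes; no; contradiction)

module _ {a p} {A : Set a} {P : A → Set p} where

  lookup-++⁺ˡ : ∀ {xs ys z} (ρ : All P xs) (ρ′ : All P ys) (v : z ∈ xs) →
                lookup (++⁺ ρ ρ′) (∈-++⁺ˡ v) ≡ lookup ρ v
  lookup-++⁺ˡ (_ ∷ _) ρ′ (here refl) = refl
  lookup-++⁺ˡ (_ ∷ ρ) ρ′ (there v)   = lookup-++⁺ˡ ρ ρ′ v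

  lookup-++⁺ʳ : ∀ {xs ys z} (ρ : All P xs) (ρ′ : All P ys) (v : z ∈ ys) →
                lookup (++⁺ ρ ρ′) (∈-++⁺ʳ xs v) ≡ lookup ρ′ v
  lookup-++⁺ʳ []      ρ′ v = refl
  lookup-++⁺ʳ (_ ∷ ρ) ρ′ v = lookup-++⁺ʳ ρ ρ′ v

  -- `copy` splits a variable by `∈-++⁻`; this brings `lookup` into the same form.
  lookup-++ : ∀ {xs ys z} (ρ : All P xs) (ρ′ : All P ys) (v : z ∈ xs ++ ys) →
              lookup (++⁺ ρ ρ′) v ≡ [ lookup ρ , lookup ρ′ ]′ (∈-++⁻ xs v)
  lookup-++ []      ρ′ v           = refl
  lookup-++ (_ ∷ _) ρ′ (here refl) = refl
  lookup-++ {xs = _ ∷ xs} (_ ∷ ρ) ρ′ (there v) with ∈-++⁻ xs v | lookup-++ ρ ρ′ v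
  ... | inj₁ _ | eq = eq
  ... | inj₂ _ | eq = eq

module _ {ℓ : Level} {S : Signature} (M : Structure ℓ S) where
  open Structure M

  module _ {Γ Δ} {r : Γ ⊆ Δ} {ρ : Valuation Δ} {ρ′ : Valuation Γ}
           (agree : ∀ {s} (v : s ∈ Γ) → lookup ρ (r v) ≡ lookup ρ′ v) where

    mutual
      eval-rename : ∀ {s} (t : Term S Γ s) → eval ρ (renameTerm r t) ≡ eval ρ′ t
      eval-rename (var v)    = agree v
      eval-rename (app f ts) = cong (funcᴵ f) (evals-rename ts)

      evals-rename : ∀ {ss} (ts : All (Term S Γ) ss) →
                     evals ρ (renameTerms r ts) ≡ evals ρ′ ts
      evals-rename []       = refl
      evals-rename (t ∷ ts) = cong₂ _∷_ (eval-rename t) (evals-rename ts)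

    -- An equality of types, so that it passes under negation and transports in both directions.
    Sat-renameLiteral : ∀ l → Sat ρ ⌊ renameLiteral r l ⌋ ≡ Sat ρ′ ⌊ l ⌋
    Sat-renameLiteral (pos q ts) = cong (relᴵ q) (evals-rename ts)
    Sat-renameLiteral (neg q ts) = cong (λ P → ¬ P) (cong (relᴵ q) (evals-rename ts))

  Sat-∃* : ∀ Δ {Γ} {ρ : Valuation Γ} {A} → Sat ρ (∃* Δ A) →
           Σ (Valuation Δ) λ v → Sat (++⁺ v ρ) A
  Sat-∃* []      h = [] , h
  Sat-∃* (s ∷ Δ) h with Sat-∃* Δ h
  ... | v , d , h′ = d ∷ v , h′

  Sat-∀* : ∀ Δ {Γ} {ρ : Valuation Γ} {A} → Sat ρ (∀* Δ A) →
           ∀ v → Sat (++⁺ v ρ) A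
  Sat-∀* []      h []      = h
  Sat-∀* (s ∷ Δ) h (d ∷ v) = Sat-∀* Δ h v d

module _ {ℓ : Level} {S : Signature} (M : Structure ℓ S) {X Y : List (Sort S)} where
  open Structure M

  private
    Tr : Set ℓ
    Tr = Trace M {X} {Y}

  instant : Tr → ℕ → Valuation (X ++ Y)
  instant σ i = ++⁺ (proj₁ (σ i)) (proj₂ (σ i))

  -- The nesting follows `Copies`, so instantiating the quantifiers of `closeCopies` by the moves of
  -- `σ` leaves exactly this valuation.
  history : ∀ k → Tr → Valuation (Copies S X Y k)
  history zero    σ = []
  history (suc k) σ = ++⁺ (proj₂ (σ k)) (++⁺ (proj₁ (σ k)) (history k σ))

  history-cong : ∀ k {σ τ : Tr} → (∀ {i} → i < k → σ i ≡ τ i) →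
                 history k σ ≡ history k τ
  history-cong zero    eq = refl
  history-cong (suc k) eq =
    cong₂ (λ m h → ++⁺ (proj₂ m) (++⁺ (proj₁ m) h))
          (eq (n<1+n k)) (history-cong k (eq ∘ m≤n⇒m≤1+n))

  -- The last d instants recorded in ρ are the first d instants of τ.
  Recorded : ∀ k d → .(d ≤ k) → Valuation (Copies S X Y k) → Tr → Set ℓ
  Recorded k d d≤k ρ τ = ∀ e (e<d : e < d) {s} (v : s ∈ X ++ Y) →
    lookup ρ (copy S X Y e k (<-≤-trans e<d d≤k) v) ≡ lookup (instant τ (d ∸ suc e)) v

  Recorded-history : ∀ k (σ : Tr) → Recorded k k ≤-refl (history k σ) σ
  Recorded-history (suc k) σ zero _ v =
    trans (latest (∈-++⁻ X v)) (sym (lookup-++ (proj₁ (σ k)) (proj₂ (σ k)) v))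
    where
    latest : ∀ w → lookup (history (suc k) σ) ([ ∈-++⁺ʳ Y ∘ ∈-++⁺ˡ , ∈-++⁺ˡ ]′ w)
                   ≡ [ lookup (proj₁ (σ k)) , lookup (proj₂ (σ k)) ]′ w
    latest (inj₁ w) = trans (lookup-++⁺ʳ (proj₂ (σ k)) _ (∈-++⁺ˡ w))
                            (lookup-++⁺ˡ (proj₁ (σ k)) _ w)
    latest (inj₂ w) = lookup-++⁺ˡ (proj₂ (σ k)) _ w
  Recorded-history (suc k) σ (suc e) e<k v =
    trans (lookup-++⁺ʳ (proj₂ (σ k)) _ _)
      (trans (lookup-++⁺ʳ (proj₁ (σ k)) _ _)
        (Recorded-history k σ e (s≤s⁻¹ e<k) v))

  -- Passing to the suffix forgets the earliest recorded instant, the one at `e = d`; the other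
  -- copies stay in place and only their index in the trace shifts.
  Recorded-suc : ∀ {k d} .(p : suc d ≤ k) ρ τ →
                 Recorded k (suc d) p ρ τ → Recorded k d (<⇒≤ p) ρ (τ ∘ suc)
  Recorded-suc p ρ τ rec e e<d v =
    trans (rec e (m≤n⇒m≤1+n e<d) v)
          (cong (λ i → lookup (instant τ i) v) (+-∸-assoc 1 e<d))

  U-suc : ∀ (τ : Tr) φ ψ → Models M τ φ → Models M (τ ∘ suc) (φ U ψ) →
          Models M τ (φ U ψ)
  U-suc τ φ ψ a (j , b , as) =
    suc j , b , λ { zero _ → a ; (suc i) i<j → as i (s≤s⁻¹ i<j) }

  module _ {k} {ρ : Valuation (Copies S X Y k)} where

    -- Instant 0 of `τ` is the earliest of the `suc d` recorded ones, hence the copy behind `d`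
    -- later ones.
    Sat-copy : ∀ {d} .(p : suc d ≤ k) τ → Recorded k (suc d) p ρ τ → ∀ l →
               Sat ρ ⌊ renameLiteral (copy S X Y d k p) l ⌋ ≡ Sat (instant τ 0) ⌊ l ⌋
    Sat-copy {d} p τ rec = Sat-renameLiteral M λ v →
      trans (rec d (n<1+n d) v) (cong (λ i → lookup (instant τ i) v) (n∸n≡0 d))

    mutual
      -- Induction on `d`, then on the formula: unfolding `U` keeps the formula but lowers `d`.
      -- `NNF` has no semantics of its own, so the induction runs over `LTL`, and the two lemmas
      -- mirror `nnf` and `nnf¬`.
      Models⇒unroll : ∀ d .(p : d ≤ k) τ → Recorded k d p ρ τ → ∀ φ →
                      Models M τ φ → ¬ ¬ Sat ρ (unrollFrom k d p (nnf φ))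
      Models⇒unroll zero    p τ rec φ a c = c tt
      Models⇒unroll (suc d) p τ rec (lit l) a c = c (subst (λ A → A) (sym (Sat-copy p τ rec l)) a)
      Models⇒unroll (suc d) p τ rec ⊤̇ a c = c tt
      Models⇒unroll (suc d) p τ rec (¬̇ φ) a = ¬Models⇒unroll (suc d) p τ rec φ a
      Models⇒unroll (suc d) p τ rec (φ ∧̇ ψ) (a , b) c =
        Models⇒unroll (suc d) p τ rec φ a λ a′ →
        Models⇒unroll (suc d) p τ rec ψ b λ b′ → c (a′ , b′)
      Models⇒unroll (suc d) p τ rec (φ ∨̇ ψ) (inj₁ a) c =
        Models⇒unroll (suc d) p τ rec φ a (c ∘ inj₁)
      Models⇒unroll (suc d) p τ rec (φ ∨̇ ψ) (inj₂ b) c =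
        Models⇒unroll (suc d) p τ rec ψ b (c ∘ inj₂)
      Models⇒unroll (suc d) p τ rec (○ φ) a =
        Models⇒unroll d (<⇒≤ p) (τ ∘ suc) (Recorded-suc p ρ τ rec) φ a
      Models⇒unroll (suc d) p τ rec (φ U ψ) (zero , b , as) c =
        Models⇒unroll (suc d) p τ rec ψ b (c ∘ inj₁)
      Models⇒unroll (suc d) p τ rec (φ U ψ) (suc j , b , as) c =
        Models⇒unroll (suc d) p τ rec φ (as 0 (s≤s z≤n)) λ a′ →
        Models⇒unroll d (<⇒≤ p) (τ ∘ suc) (Recorded-suc p ρ τ rec) (φ U ψ)
          (j , b , λ i i<j → as (suc i) (s≤s i<j)) λ u′ →
        c (inj₂ (a′ , u′))

      ¬Models⇒unroll : ∀ d .(p : d ≤ k) τ → Recorded k d p ρ τ → ∀ φ →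
                       ¬ Models M τ φ → ¬ ¬ Sat ρ (unrollFrom k d p (nnf¬ φ))
      ¬Models⇒unroll zero    p τ rec φ ¬a c = c tt
      ¬Models⇒unroll (suc d) p τ rec (lit l) ¬a c =
        c (¬a ∘ subst (λ A → A) (Sat-copy p τ rec l))
      ¬Models⇒unroll (suc d) p τ rec ⊤̇ ¬a c = ¬a tt
      ¬Models⇒unroll (suc d) p τ rec ⊥̇ ¬a c = c tt
      ¬Models⇒unroll (suc d) p τ rec (¬̇ φ) ¬¬a c =
        ¬¬a λ a → Models⇒unroll (suc d) p τ rec φ a c
      -- Constructive De Morgan: given `a`, `¬ab` refutes `ψ`, which `c ∘ inj₂` excludes; so `φ`
      -- fails, which `c ∘ inj₁` excludes.
      ¬Models⇒unroll (suc d) p τ rec (φ ∧̇ ψ) ¬ab c =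
        ¬Models⇒unroll (suc d) p τ rec φ
          (λ a → ¬Models⇒unroll (suc d) p τ rec ψ (λ b → ¬ab (a , b)) (c ∘ inj₂))
          (c ∘ inj₁)
      ¬Models⇒unroll (suc d) p τ rec (φ ∨̇ ψ) ¬ab c =
        ¬Models⇒unroll (suc d) p τ rec φ (¬ab ∘ inj₁) λ a′ →
        ¬Models⇒unroll (suc d) p τ rec ψ (¬ab ∘ inj₂) λ b′ → c (a′ , b′)
      ¬Models⇒unroll (suc d) p τ rec (○ φ) ¬a =
        ¬Models⇒unroll d (<⇒≤ p) (τ ∘ suc) (Recorded-suc p ρ τ rec) φ ¬a
      -- If `ψ` held now, `j = 0` would witness the until. If `φ` holds now, the until fails on the
      -- suffix by `U-suc`, giving the right disjunct of the unrolled release; if `φ` fails, the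
      -- left one results.
      ¬Models⇒unroll (suc d) p τ rec (φ U ψ) ¬u c =
        ¬Models⇒unroll (suc d) p τ rec ψ (λ b → ¬u (0 , b , λ _ ())) λ b′ →
        ¬Models⇒unroll (suc d) p τ rec φ
          (λ a → ¬Models⇒unroll d (<⇒≤ p) (τ ∘ suc) (Recorded-suc p ρ τ rec) (φ U ψ)
                   (¬u ∘ U-suc τ φ ψ a) λ u′ → c (b′ , inj₂ u′))
          λ a′ → c (b′ , inj₁ a′)

  module _ (s : Strategy M X Y) where

    -- Causality: the system's move at turn `i` sees only the environment's moves up to turn `i`.
    outcome-cong : ∀ {ξ ζ : ℕ → Valuation X} {k} → (∀ {i} → i < k → ξ i ≡ ζ i) →
                   ∀ {i} → i < k → outcome M X Y s ξ i ≡ outcome M X Y s ζ i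
    outcome-cong eq {i} i<k = cong₂ _,_ (eq i<k)
      (cong (s i) (tabulate-cong λ j → eq (<-≤-trans (toℕ<n j) i<k)))

    override : (ℕ → Valuation X) → ℕ → Valuation X → ℕ → Valuation X
    override ξ k x i with i ≟ k
    ... | yes _ = x
    ... | no  _ = ξ i

    override-≡ : ∀ ξ k x → override ξ k x k ≡ x
    override-≡ ξ k x with k ≟ k
    ... | yes _  = refl
    ... | no k≢k = contradiction refl k≢k

    override-< : ∀ ξ k x {i} → i < k → override ξ k x i ≡ ξ i
    override-< ξ k x {i} i<k with i ≟ k
    ... | yes i≡k = contradiction i≡k (<⇒≢ i<k)
    ... | no  _   = refl

    -- The default x₀ is only used from turn k on, where the formula no longer
    -- prescribes a move for the environment.
    play : Valuation X → ∀ k {A} → Sat [] (closeCopies S X Y k A) →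
           ∃[ ξ ] Sat (history k (outcome M X Y s ξ)) A
    play x₀ zero    h = (λ _ → x₀) , h
    -- The last turn is the innermost block, so the first `k` turns are played for the formula
    -- `∃* X (∀* Y A)`.
    play x₀ (suc k) {A} h with play x₀ k h
    ... | ξ , h₁ with Sat-∃* M X h₁
    ...   | x , h₂ = ξ′ , subst (λ v → Sat v A) extended (Sat-∀* M Y h₂ y)
      where
      ξ′ = override ξ k x
      -- The reply is computed against `ξ′`, not `ξ`: at turn `k` the system already sees `x`.
      y  = proj₂ (outcome M X Y s ξ′ k)

      extended : ++⁺ y (++⁺ x (history k (outcome M X Y s ξ)))
                 ≡ history (suc k) (outcome M X Y s ξ′)
      extended = cong₂ (λ x h → ++⁺ y (++⁺ x h)) (sym (override-≡ ξ k x))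
        (sym (history-cong k (outcome-cong (override-< ξ k x))))

  -- Carriers may be empty, so the default move of play has to come from here.
  firstMove : ∀ k {A} → Sat [] (closeCopies S X Y (suc k) A) → Valuation X
  firstMove zero    h = proj₁ (Sat-∃* M X h)
  firstMove (suc k) h = firstMove k h

theorem4 : {ℓ : Level} (T : Theory ℓ) (X Y : List (Sort (signature T)))
    (φ : LTL (signature T) X Y) →
    (∃[ k ] ((1 ≤ k) × (structure T ⊨ conditionalUnrolling k φ))) →
    Unrealizable (structure T) φ
-- A positive depth provides a first existential block, whose witness serves as the default move.
theorem4 T X Y φ (suc k , _ , h) (s , winning)
  with play (structure T) s (firstMove (structure T) k h) (suc k) h
... | ξ , falsified =
  Models⇒unroll M (suc k) ≤-refl σ (Recorded-history M (suc k) σ) φ (winning ξ) falsified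
  where
  M = structure T
  σ = outcome M X Y s ξ
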